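{- Let $n$ be a positive integer and $g=3n+1$. If $G$ is a pure $(2n)$-sparse gapset of genus $g$, then $G$ is not pseudo-symmetric.
   Context: A gapset is a finite set $G\subset\mathbb{N}=\{1,2,\dots\}$ such that whenever $z\in G$ and $z=x+y$ with $x,y\in\mathbb{N}$, then $x\in G$ or $y\in G$; its genus is $g=\#G$. Writing $G=\{\ell_1<\dots<\ell_g\}$, the Frobenius number is $F(G)=\ell_g$; $G$ is pseudo-symmetric if $F(G)=2g-2$. $G$ is pure $\kappa$-sparse if $\ell_{i+1}-\ell_i\le\kappa$ for all $i$ with equality for some $i$. -}

module Defs where

open import Data.List.Base using (List; length; last; zipWith; drop)
open import Data.List.Membership.Propositional using (_∈_)
open import Data.List.Relation.Unary.All using (All)
open import Data.List.Relation.Unary.Linked using (Linked)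
open import Data.Maybe.Base using (Maybe; just)
open import Data.Nat.Base using (ℕ; _+_; _*_; _∸_; _≤_; _<_)
open import Data.Product.Base using (_×_)
open import Data.Sum.Base using (_⊎_)
open import Relation.Binary.PropositionalEquality using (_≡_)

-- A finite set of positive integers is represented by its increasing
-- enumeration ℓ₁ < … < ℓ_g, which it determines uniquely.
record Gapset : Set where
  field
    elements   : List ℕ
    increasing : Linked _<_ elements
    positive   : All (1 ≤_) elements
    split      : ∀ x y → 1 ≤ x → 1 ≤ y → x + y ∈ elements →
                 x ∈ elements ⊎ y ∈ elements

open Gapset public

genus : Gapset → ℕ
genus G = length (elements G)

-- The largest element; `nothing` only for the empty gapset.
frobenius : Gapset → Maybe ℕ
frobenius G = last (elements G)

-- Truncated subtraction is harmless: frobenius G is a `just` only when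
-- genus G ≥ 1, and then 2 ≤ 2 * genus G.
PseudoSymmetric : Gapset → Set
PseudoSymmetric G = frobenius G ≡ just (2 * genus G ∸ 2)

-- The list ℓ₂ - ℓ₁ , … , ℓ_g - ℓ_{g-1}; zipWith stops at the shorter list,
-- and the subtractions are exact because the enumeration is increasing.
differences : Gapset → List ℕ
differences G = zipWith _∸_ (drop 1 (elements G)) (elements G)

PureSparse : ℕ → Gapset → Set
PureSparse κ G = All (_≤ κ) (differences G) × κ ∈ differences G

{-# OPTIONS --safe #-}
-- Here F = 6n.  Suppose a < b = a + 2n are consecutive gaps.  As 6n = 2n + 2n + 2n,
-- 2n is a gap, whence 2n ≤ a and c = 6n − b ≤ 2n.  In a pseudo-symmetric gapset
-- two gaps with sum F are both equal to F/2 = 3n.  If c = 0, this is violated by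
-- a = 4n and 2n.  Otherwise c is not a gap, because b ≠ 3n is one; in particular
-- c < 2n, and b = c + (b − c) makes b − c a gap strictly between a and b.
module Submission where

open import Data.Fin.Base using (Fin; toℕ)
open import Data.Fin.Properties using (injective⇒≤; toℕ-injective; toℕ≤pred[n])
open import Data.List.Base using (List; []; _∷_; _++_; length; last; map; filter; zipWith; drop; lookup)
open import Data.List.Membership.Propositional using (_∈_; _∉_; lose)
open import Data.List.Membership.Propositional.Properties
  using (∈-++⁺ˡ; ∈-++⁺ʳ; ∈-map⁺; ∈-filter⁺)
open import Data.List.Membership.DecPropositional using (_∈?_)
open import Data.List.Properties using (filter-notAll; length-++; length-map)
open import Data.List.Relation.Unary.All as All using ()
open import Data.List.Relation.Unary.Any using (here; there; index)
open import Data.List.Relation.Unary.Any.Properties using (lookup-index)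
open import Data.List.Relation.Unary.Linked as Linked using (Linked; [-]; _∷_)
open import Data.List.Relation.Unary.Linked.Properties using (Linked⇒All)
open import Data.Maybe.Base using (just)
open import Data.Nat.Base using (ℕ; zero; suc; _+_; _*_; _∸_; _≤_; _<_; z≤n; s≤s)
open import Data.Nat.Properties
open import Data.Nat.Tactic.RingSolver using (solve-∀)
open import Data.Product.Base using (_×_; _,_; ∃₂)
open import Data.Sum.Base using (_⊎_; inj₁; inj₂; [_,_]′)
open import Function.Base using (id)
open import Relation.Binary.PropositionalEquality
  using (_≡_; _≢_; refl; sym; trans; cong; subst)
open import Relation.Nullary using (¬_; yes; no; contradiction)
open import Relation.Nullary.Decidable using (¬?)
open import Defs

-- Pigeonhole: sending k to its position in `xs` is injective, because looking up that position
-- returns k.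
≤-length-of-initial-segment : ∀ {m} (xs : List ℕ) → (∀ k → k ≤ m → k ∈ xs) → suc m ≤ length xs
≤-length-of-initial-segment {m} xs mem = injective⇒≤ {f = position} injective
  where
  mem′ : (i : Fin (suc m)) → toℕ i ∈ xs
  mem′ i = mem (toℕ i) (toℕ≤pred[n] i)

  position : Fin (suc m) → Fin (length xs)
  position i = index (mem′ i)

  injective : ∀ {i j} → position i ≡ position j → i ≡ j
  injective {i} {j} eq = toℕ-injective
    (trans (lookup-index (mem′ i)) (trans (cong (lookup xs) eq) (sym (lookup-index (mem′ j)))))

last-∈ : ∀ {A : Set} (xs : List A) {l} → last xs ≡ just l → l ∈ xs
last-∈ (x ∷ [])     refl = here refl
last-∈ (x ∷ y ∷ xs) eq   = there (last-∈ (y ∷ xs) eq)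

≤-last : ∀ {xs l} → Linked _<_ xs → last xs ≡ just l → ∀ {z} → z ∈ xs → z ≤ l
≤-last [-]         refl (here refl) = ≤-refl
≤-last (x<y ∷ inc) eq   (here refl) = ≤-trans (<⇒≤ x<y) (≤-last inc eq (here refl))
≤-last (x<y ∷ inc) eq   (there z∈)  = ≤-last inc eq z∈

-- Adjacency is phrased by order alone, without list indices, so that any gap produced later can be
-- tested against the pair.
Consecutive : List ℕ → ℕ → ℕ → Set
Consecutive xs a b = a ∈ xs × b ∈ xs × a < b × (∀ {z} → z ∈ xs → z ≤ a ⊎ b ≤ z)

difference⇒consecutive : ∀ {xs d} → Linked _<_ xs → d ∈ zipWith _∸_ (drop 1 xs) xs →
  ∃₂ λ a b → Consecutive xs a b × b ≡ a + d
difference⇒consecutive {x ∷ y ∷ xs} (x<y ∷ inc) (here refl) =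
  x , y , (here refl , there (here refl) , x<y , separated) , sym (m+[n∸m]≡n (<⇒≤ x<y))
  where
  separated : ∀ {z} → z ∈ x ∷ y ∷ xs → z ≤ x ⊎ y ≤ z
  separated (here refl) = inj₁ ≤-refl
  separated (there z∈)  = inj₂ (All.lookup (Linked⇒All ≤-trans ≤-refl (Linked.map <⇒≤ inc)) z∈)
difference⇒consecutive {x ∷ y ∷ xs} (x<y ∷ inc) (there d∈)
  with a , b , (a∈ , b∈ , a<b , sep) , eq ← difference⇒consecutive inc d∈ =
  a , b , (there a∈ , there b∈ , a<b , separated) , eq
  where
  x<tail : ∀ {z} → z ∈ y ∷ xs → x < z
  x<tail = All.lookup (Linked⇒All <-trans x<y inc)
  separated : ∀ {z} → z ∈ x ∷ y ∷ xs → z ≤ a ⊎ b ≤ z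
  separated (here refl) = inj₁ (<⇒≤ (x<tail a∈))
  separated (there z∈)  = sep z∈

module _ (G : Gapset) where

  private
    E : List ℕ
    E = elements G

  positive-∈ : ∀ {x} → x ∈ E → 1 ≤ x
  positive-∈ = All.lookup (positive G)

  -- Both outcomes of `split` name the same summand. It asks for positive summands, so zero is
  -- treated apart, where `0 + 0` computes to `0`.
  double-∈ : ∀ {x} → x + x ∈ E → x ∈ E
  double-∈ {zero}  0∈ = 0∈
  double-∈ {suc x} 2x∈ = [ id , id ]′ (split G (suc x) (suc x) (s≤s z≤n) (s≤s z≤n) 2x∈)

  triple-∈ : ∀ {x} → x + (x + x) ∈ E → x ∈ E
  triple-∈ {zero}  0∈ = 0∈
  triple-∈ {suc x} 3x∈ =
    [ id , double-∈ ]′ (split G (suc x) (suc x + suc x) (s≤s z≤n) (s≤s z≤n) 3x∈)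

  complement-∈ : ∀ {F y} → F ∈ E → y ≤ F → y ∉ E → F ∸ y ∈ E
  complement-∈ {F} {zero} F∈ _ _ = F∈
  complement-∈ {F} {y@(suc _)} F∈ y≤F y∉ with m≤n⇒m<n∨m≡n y≤F
  ... | inj₂ refl = contradiction F∈ y∉
  ... | inj₁ y<F =
    [ (λ y∈ → contradiction y∈ y∉) , id ]′
      (split G y (F ∸ y) (s≤s z≤n) (m<n⇒0<n∸m y<F) (subst (_∈ E) (sym (m+[n∸m]≡n y≤F)) F∈))

  -- E and its reflection z ↦ 2h − z cover {0, …, 2h}.  If x ≢ h, the reflected
  -- copy still covers the complement of E after both h and x are dropped from it,
  -- which leaves too few elements.
  gaps-summing-to-frobenius : ∀ {h x y} → genus G ≡ suc h → h + h ∈ E →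
    x ∈ E → y ∈ E → x + y ≡ h + h → x ≡ h
  gaps-summing-to-frobenius {h} {x} {y} g≡ F∈ x∈ y∈ x+y≡F with x ≟ h
  ... | yes x≡h = x≡h
  ... | no  x≢h = contradiction too-few (<-irrefl refl)
    where
    ≢h? = λ z → ¬? (z ≟ h)
    ≢x? = λ z → ¬? (z ≟ x)

    E₁ E₂ : List ℕ
    E₁ = filter ≢h? E
    E₂ = filter ≢x? E₁

    |E₂|<h : length E₂ < h
    -- Each filter drops at least one element: first `h`, a gap because `h + h` is one, then `x`. Of
    -- h + 1 elements at most h - 1 remain.
    |E₂|<h = ≤-pred (subst (suc (suc (length E₂)) ≤_) g≡ (≤-trans
      (s≤s (filter-notAll ≢x? E₁ (lose (∈-filter⁺ ≢h? x∈ x≢h) (λ ≢x → ≢x refl))))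
      (filter-notAll ≢h? E (lose (double-∈ F∈) (λ ≢h → ≢h refl)))))

    cover : ∀ k → k ≤ h + h → k ∈ E ++ map (h + h ∸_) E₂
    cover k k≤F with _∈?_ _≟_ k E
    ... | yes k∈ = ∈-++⁺ˡ k∈
    -- The reflection of a non-gap k is a gap; were it `h` or `x`, then k would be `h` or `y`, both
    -- gaps.
    ... | no  k∉ = ∈-++⁺ʳ E (subst (_∈ map (h + h ∸_) E₂) (m∸[m∸n]≡n k≤F)
      (∈-map⁺ (h + h ∸_) (∈-filter⁺ ≢x? (∈-filter⁺ ≢h? (complement-∈ F∈ k≤F k∉) F-k≢h) F-k≢x)))
      where
      reflect : ∀ {z w} → z + w ≡ h + h → w ∈ E → h + h ∸ k ≢ z
      reflect {z} {w} z+w≡F w∈ F-k≡z = k∉ (subst (_∈ E) w≡k w∈)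
        where
        w≡k : w ≡ k
        w≡k = +-cancelˡ-≡ z w k
          (trans z+w≡F (trans (sym (m∸n+n≡m k≤F)) (cong (_+ k) F-k≡z)))
      F-k≢h : h + h ∸ k ≢ h
      F-k≢h = reflect refl (double-∈ F∈)
      F-k≢x : h + h ∸ k ≢ x
      F-k≢x = reflect x+y≡F y∈

    too-few : suc (h + h) < suc (h + h)
    too-few = begin-strict
      suc (h + h)                          ≤⟨ ≤-length-of-initial-segment _ cover ⟩
      length (E ++ map (h + h ∸_) E₂)      ≡⟨ length-++ E ⟩
      length E + length (map (h + h ∸_) E₂) ≡⟨ cong (length E +_) (length-map _ E₂) ⟩
      length E + length E₂                 ≡⟨ cong (_+ length E₂) g≡ ⟩
      suc h + length E₂                    <⟨ +-monoʳ-< (suc h) |E₂|<h ⟩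
      suc h + h                            ∎
      where open ≤-Reasoning

  -- Used with `m` = 2n and `h` = 3n; genus h + 1 and Frobenius number 2h express pseudo-symmetry.
  no-consecutive-gaps : ∀ {m h a b} → m < h → h < m + m → m + (m + m) ≡ h + h →
    genus G ≡ suc h → frobenius G ≡ just (h + h) →
    Consecutive E a b → b ≢ a + m
  no-consecutive-gaps {m} {h} {a} {b} m<h h<2m 3m≡F g≡ fr (a∈ , b∈ , _ , separated) refl =
    by-complement (h + h ∸ b) (m+[n∸m]≡n (≤-last (increasing G) fr b∈))
    where
    F∈ : h + h ∈ E
    F∈ = last-∈ E fr

    m∈ : m ∈ E
    m∈ = triple-∈ (subst (_∈ E) (sym 3m≡F) F∈)

    m≤a : m ≤ a
    -- The alternative b ≤ m fails because b = a + m with `a` positive.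
    m≤a = [ id , (λ b≤m → contradiction b≤m (<⇒≱ (m<n+m m (positive-∈ a∈)))) ]′ (separated m∈)

    2m≤b : m + m ≤ b
    2m≤b = +-monoˡ-≤ m m≤a

    b≢h : b ≢ h
    b≢h refl = <⇒≱ h<2m 2m≤b

    -- A variable `c` replaces `h + h ∸ b` so that it can be split into zero and positive.
    by-complement : ∀ c → b + c ≢ h + h
    by-complement zero b+0≡F = <⇒≢ m<h
      (gaps-summing-to-frobenius g≡ F∈ m∈ a∈
        (trans (+-comm m a) (trans (sym (+-identityʳ b)) b+0≡F)))
    by-complement c@(suc _) b+c≡F =
      -- As a = b - m, b - c ≤ a would give m ≤ c, while b ≤ b - c contradicts c > 0.
      [ (λ b-c≤a → <⇒≱ c<m (+-cancelˡ-≤ a m c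
          (subst (_≤ a + c) (m∸n+n≡m c≤b) (+-monoˡ-≤ c b-c≤a))))
      , <⇒≱ (∸-monoʳ-< (s≤s z≤n) c≤b)
      ]′ (separated b-c∈)
      where
      c∉ : c ∉ E
      c∉ c∈ = b≢h (gaps-summing-to-frobenius g≡ F∈ b∈ c∈ b+c≡F)

      c≤m : c ≤ m
      c≤m = +-cancelˡ-≤ (m + m) c m (begin
        m + m + c   ≤⟨ +-monoˡ-≤ c 2m≤b ⟩
        b + c       ≡⟨ trans b+c≡F (sym 3m≡F) ⟩
        m + (m + m) ≡⟨ +-assoc m m m ⟨
        m + m + m   ∎)
        where open ≤-Reasoning

      c<m : c < m
      c<m = ≤∧≢⇒< c≤m λ c≡m → c∉ (subst (_∈ E) (sym c≡m) m∈)

      c≤b : c ≤ b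
      c≤b = ≤-trans c≤m (m≤n+m m a)

      b-c∈ : b ∸ c ∈ E
      -- The gap `b` takes the role of `F` here.
      b-c∈ = complement-∈ b∈ c≤b c∉

mainTheorem7 : (n : ℕ) → 1 ≤ n → (G : Gapset) → genus G ≡ 3 * n + 1 →
    PureSparse (2 * n) G → ¬ PseudoSymmetric G
mainTheorem7 n 1≤n G g≡ (_ , 2n∈) ps
  with a , b , consecutive , b≡a+2n ← difference⇒consecutive (increasing G) 2n∈ =
  no-consecutive-gaps G 2n<3n 3n<4n (3[2n]≡2[3n] n) g≡1+3n
    (trans ps (cong just F≡)) consecutive b≡a+2n
  where
  2n<3n : 2 * n < 3 * n
  -- `3 * n` unfolds to `n + 2 * n`, so positivity of `n` gives strictness.
  2n<3n = m<n+m (2 * n) 1≤n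

  3n<4n : 3 * n < 2 * n + 2 * n
  3n<4n = subst (3 * n <_) (n+3n≡4n n) (m<n+m (3 * n) 1≤n)
    where
    n+3n≡4n : ∀ n → n + 3 * n ≡ 2 * n + 2 * n
    n+3n≡4n = solve-∀

  3[2n]≡2[3n] : ∀ n → 2 * n + (2 * n + 2 * n) ≡ 3 * n + 3 * n
  3[2n]≡2[3n] = solve-∀

  g≡1+3n : genus G ≡ suc (3 * n)
  g≡1+3n = trans g≡ (+-comm (3 * n) 1)

  F≡ : 2 * genus G ∸ 2 ≡ 3 * n + 3 * n
  -- Writing the double as 2 + (k + k) lets the truncated subtraction compute.
  F≡ = trans (cong (λ g → 2 * g ∸ 2) g≡1+3n) (cong (_∸ 2) (double-suc (3 * n)))
    where
    double-suc : ∀ k → 2 * suc k ≡ 2 + (k + k)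
    double-suc = solve-∀
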